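{- There is a positive constant $c$ such that for all integers $n,k$ with $n\ge k\ge 2$, \[ \frac{n(n-1)}{k(k-1)}\;\le\;\overline{m}(n,k)\;\le\; c\cdot\frac{n(n-1)}{k(k-1)} . \]
   Context: A hypergraph is an ordered pair $(X,H)$ such that $X$ is a set (of vertices) and $H$ is a family of subsets of $X$ (edges, which may have arbitrary sizes). A set $T$ of vertices in a hypergraph is called affinely closed if, and only if, every edge that shares at least two vertices with $T$ is fully contained in $T$. For every set $S$ of vertices, the affine closure $\mathrm{aff}(S)$ is the intersection of all affinely closed supersets of $S$ (it is itself affinely closed). The closure-lines in the hypergraph are all the sets $\mathrm{aff}(\{u,v\})$ with $u$ and $v$ two distinct vertices. For integers $n,k$, $\overline{m}(n,k)$ denotes the smallest number of (distinct) closure-lines in a hypergraph on $n$ vertices where every closure-line consists of at most $k$ vertices. -}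

module Defs where

open import Data.Bool.Properties as Bool using ()
open import Data.Fin using (Fin)
open import Data.Fin.Properties as Fin using ()
open import Data.Fin.Subset using (Subset; inside; outside; ⁅_⁆; _∪_; _∩_; ⋂; ∣_∣; _∈_; _⊆_)
open import Data.Fin.Subset.Properties using (_⊆?_; ∈⊤; x∈p∩q⁺; x∈p∩q⁻)
open import Data.Integer using (+_)
open import Data.List using (List; []; _∷_; [_]; _++_; map; filter; length; deduplicate; allFin; cartesianProduct)
open import Data.List.Membership.Propositional as List using ()
open import Data.List.Membership.Propositional.Properties
  using (∈-map⁺; ∈-++⁺ˡ; ∈-++⁺ʳ; ∈-filter⁺; ∈-filter⁻)
open import Data.List.Relation.Unary.All using (All; all?)
open import Data.List.Relation.Unary.Any using (here; there)
open import Data.Nat using (ℕ; suc; zero; _≤_; _*_; _∸_; s≤s; z≤n; NonZero)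
open import Data.Nat.Properties using (_≤?_)
open import Data.Product using (Σ-syntax; _×_; _,_; proj₁; proj₂)
open import Data.Rational using (ℚ; _/_)
open import Data.Vec using ([]; _∷_)
open import Data.Vec.Properties using (≡-dec)
open import Function.Bundles using (_⇔_; mk⇔)
open import Relation.Binary.Definitions using (DecidableEquality)
open import Relation.Binary.PropositionalEquality using (_≡_; refl)
open import Relation.Nullary using (Dec; ¬?)
open import Relation.Nullary.Decidable using (_×-dec_; _→-dec_)

-- The vertex set is Fin n.  The edges are listed; order and repetitions in the
-- list play no role below.
Hypergraph : ℕ → Set
Hypergraph n = List (Subset n)

module _ {n : ℕ} where

  AffinelyClosed : Hypergraph n → Subset n → Set
  AffinelyClosed H T = All (λ e → 2 ≤ ∣ e ∩ T ∣ → e ⊆ T) H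

  affinelyClosed? : ∀ H T → Dec (AffinelyClosed H T)
  affinelyClosed? H T = all? (λ e → (2 ≤? ∣ e ∩ T ∣) →-dec (e ⊆? T)) H

  _≟ˢ_ : DecidableEquality (Subset n)
  _≟ˢ_ = ≡-dec Bool._≟_

allSubsets : ∀ n → List (Subset n)
allSubsets zero    = [ [] ]
allSubsets (suc n) = map (outside ∷_) (allSubsets n) ++ map (inside ∷_) (allSubsets n)

∈-allSubsets : ∀ {n} (S : Subset n) → S List.∈ allSubsets n
∈-allSubsets []            = here refl
∈-allSubsets (outside ∷ S) = ∈-++⁺ˡ (∈-map⁺ _ (∈-allSubsets S))
∈-allSubsets (inside  ∷ S) = ∈-++⁺ʳ _ (∈-map⁺ _ (∈-allSubsets S))

module _ {n : ℕ} (H : Hypergraph n) where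

  aff : Subset n → Subset n
  aff S = ⋂ (filter (λ T → affinelyClosed? H T ×-dec (S ⊆? T)) (allSubsets n))

  distinctPairs : List (Fin n × Fin n)
  distinctPairs = filter (λ (u , v) → ¬? (u Fin.≟ v)) (cartesianProduct (allFin n) (allFin n))

  -- Each closure-line occurs exactly once, so the length of this list is the
  -- number of distinct closure-lines.
  closureLines : List (Subset n)
  closureLines = deduplicate _≟ˢ_ (map (λ (u , v) → aff (⁅ u ⁆ ∪ ⁅ v ⁆)) distinctPairs)

module _ {n : ℕ} where

  ∈-⋂⁺ : ∀ {x : Fin n} Ts → (∀ {T} → T List.∈ Ts → x ∈ T) → x ∈ ⋂ Ts
  ∈-⋂⁺ []       x∈ = ∈⊤
  ∈-⋂⁺ (T ∷ Ts) x∈ = x∈p∩q⁺ (x∈ (here refl) , ∈-⋂⁺ Ts (λ T∈ → x∈ (there T∈)))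

  ∈-⋂⁻ : ∀ {x : Fin n} Ts → x ∈ ⋂ Ts → ∀ {T} → T List.∈ Ts → x ∈ T
  ∈-⋂⁻ (T ∷ Ts) x∈ (here refl) = proj₁ (x∈p∩q⁻ T (⋂ Ts) x∈)
  ∈-⋂⁻ (T ∷ Ts) x∈ (there T∈)  = ∈-⋂⁻ Ts (proj₂ (x∈p∩q⁻ T (⋂ Ts) x∈)) T∈

  ∈-aff : ∀ H S {x : Fin n} → x ∈ aff H S ⇔ (∀ T → AffinelyClosed H T → S ⊆ T → x ∈ T)
  ∈-aff H S {x} = mk⇔
    (λ x∈ T closed S⊆T →
      ∈-⋂⁻ _ x∈ (∈-filter⁺ P? (∈-allSubsets T) (closed , λ {y} → S⊆T {y})))
    (λ f → ∈-⋂⁺ _ (λ {T} T∈ → let p = proj₂ (∈-filter⁻ P? {xs = allSubsets n} T∈)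
                              in f T (proj₁ p) (λ {y} → proj₂ p {y})))
    where
    P : Subset n → Set
    P T = AffinelyClosed H T × S ⊆ T

    P? : ∀ T → Dec (P T)
    P? T = affinelyClosed? H T ×-dec (S ⊆? T)

LinesAtMost : ∀ {n} → ℕ → Hypergraph n → Set
LinesAtMost k H = All (λ L → ∣ L ∣ ≤ k) (closureLines H)

-- m̄(n,k) = m
record IsMinLines (n k m : ℕ) : Set where
  field
    attained : Σ[ H ∈ Hypergraph n ] LinesAtMost k H × length (closureLines H) ≡ m
    minimal  : ∀ (H : Hypergraph n) → LinesAtMost k H → m ≤ length (closureLines H)

k[k-1]≢0 : ∀ {k} → 2 ≤ k → NonZero (k * (k ∸ 1))
k[k-1]≢0 (s≤s (s≤s z≤n)) = _

pairRatio : (n k : ℕ) → 2 ≤ k → ℚ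
pairRatio n k 2≤k = (+ (n * (n ∸ 1)) / (k * (k ∸ 1))) {{k[k-1]≢0 2≤k}}

{-# OPTIONS --safe #-}

-- Lower bound: an ordered pair of distinct vertices is determined by the
-- closure-line it spans and by its two positions on that line.
--
-- Upper bound: with b = ⌊k/3⌋ ≥ 3, map the n vertices onto the P = 3^(d+1) points
-- of the affine space over F₃, with fibres of size at most b, where
-- 3^d b < n ≤ 3^(d+1) b.  Take every edge for which all preimages of the lines of
-- the space remain affinely closed.  Then the closure-line through u and v is the
-- preimage of the line through their images (of a single point if the images
-- agree), so that there are at most P² closure-lines, each of size at most 3b ≤ k,
-- and P k ≤ 12 · 3^d b.  For k < 9 the hypergraph without edges is good enough.
module Submission where

open import Defs
open import Data.Bool using (true; false)
open import Data.Fin as Fin using (Fin; zero; suc; toℕ; inject≤; fromℕ<; combine; remQuot; punchIn; punchOut)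
open import Data.Fin.Properties as Fin using (injective⇒≤)
open import Data.Fin.Subset using (Subset; inside; outside; ⁅_⁆; _∪_; _∩_; ⋂; ∣_∣; _∈_; _⊆_)
open import Data.Fin.Subset.Properties
  using (_⊆?_; ⊆-antisym; x∈p∩q⁺; x∈p∩q⁻; x∈p∪q⁺; x∈p∪q⁻; x∈⁅x⁆; x∈⁅y⁆⇒x≡y; ∣⁅x⁆∣≡1; p⊆q⇒∣p∣≤∣q∣)
open import Data.Integer as ℤ using (+_)
import Data.Integer.Properties as ℤ
open import Data.List
  using (List; []; _∷_; [_]; _++_; map; filter; length; lookup; allFin; cartesianProduct; deduplicate)
import Data.List.Extrema
import Data.List.Membership.Propositional as List
import Data.List.Membership.DecPropositional as DecMembership
open import Data.List.Membership.Propositional.Properties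
  using (∈-map⁺; ∈-map⁻; ∈-++⁺ˡ; ∈-++⁺ʳ; ∈-filter⁺; ∈-filter⁻; ∈-lookup;
         ∈-cartesianProduct⁺; ∈-allFin; ∈-deduplicate⁺; ∈-deduplicate⁻)
open import Data.List.Properties using (filter-≐; map-cong)
open import Data.List.Relation.Unary.All as All using (All; []; _∷_; all?)
open import Data.List.Relation.Unary.All.Properties using (all-filter)
open import Data.List.Relation.Unary.Any as Any using (here; there)
open import Data.List.Relation.Unary.Any.Properties using (lookup-index)
open import Data.List.Relation.Unary.Unique.Propositional using (Unique; []; _∷_)
open import Data.List.Relation.Unary.Unique.DecPropositional.Properties using (deduplicate-!)
open import Data.Nat as ℕ using (ℕ; zero; suc; NonZero; z≤n; s≤s; _^_)
  renaming (_≤_ to _≤ℕ_; _<_ to _<ℕ_; _*_ to _*ℕ_; _+_ to _+ℕ_)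
open import Data.Nat.DivMod as ℕ
  using (_mod_; _%_; m≡m%n+[m/n]*n; m%n<n; m<n⇒m%n≡m; m<n*o⇒m/o<n; /-monoˡ-≤; m/n*n≤m)
import Data.Nat.Properties as ℕ
open import Data.Nat.Solver using (module +-*-Solver)
open import Data.Product using (Σ-syntax; ∃; ∃₂; _×_; _,_; proj₁; proj₂; uncurry)
open import Data.Rational using (ℚ; 0ℚ; _<_; _≤_; _*_; _/_; toℚᵘ)
import Data.Rational.Properties as ℚ
import Data.Rational.Unnormalised as ℚᵘ
import Data.Rational.Unnormalised.Properties as ℚᵘ
open import Data.Sum using (_⊎_; inj₁; inj₂)
open import Data.Vec using ([]; _∷_; tabulate; here; there)
open import Data.Vec.Properties using ([]=⇒lookup; lookup⇒[]=; lookup∘tabulate)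
open import Function using (_∘_)
open import Function.Bundles using (module Equivalence)
open import Relation.Binary.PropositionalEquality using (_≡_; _≢_; refl; sym; trans; cong; cong₂; subst; subst₂)
open import Relation.Nullary using (yes; no; does; contradiction)
open import Relation.Nullary.Decidable using (_×-dec_; _→-dec_; dec-true; from-yes; ¬?)
open import Relation.Unary using (Decidable)

-- Cardinality of finite subsets

elements : ∀ {n} (S : Subset n) → Fin ∣ S ∣ → Fin n
elements (inside  ∷ S) zero    = zero
elements (inside  ∷ S) (suc i) = suc (elements S i)
elements (outside ∷ S) i       = suc (elements S i)

elements-∈ : ∀ {n} (S : Subset n) i → elements S i ∈ S
elements-∈ (inside  ∷ S) zero    = here
elements-∈ (inside  ∷ S) (suc i) = there (elements-∈ S i)
elements-∈ (outside ∷ S) i       = there (elements-∈ S i)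

elements-injective : ∀ {n} (S : Subset n) {i j} → elements S i ≡ elements S j → i ≡ j
elements-injective (inside  ∷ S) {zero}  {zero}  eq = refl
elements-injective (inside  ∷ S) {suc i} {suc j} eq = cong suc (elements-injective S (Fin.suc-injective eq))
elements-injective (outside ∷ S)                 eq = elements-injective S (Fin.suc-injective eq)

rank : ∀ {n} {S : Subset n} {x} → x ∈ S → Fin ∣ S ∣
rank {S = inside  ∷ S} here        = zero
rank {S = inside  ∷ S} (there x∈S) = suc (rank x∈S)
rank {S = outside ∷ S} (there x∈S) = rank x∈S

rank-injective : ∀ {n} {S : Subset n} {x y} (x∈S : x ∈ S) (y∈S : y ∈ S) → rank x∈S ≡ rank y∈S → x ≡ y
rank-injective {S = inside  ∷ S} here        here        eq = refl
rank-injective {S = inside  ∷ S} (there x∈S) (there y∈S) eq = cong suc (rank-injective x∈S y∈S (Fin.suc-injective eq))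
rank-injective {S = outside ∷ S} (there x∈S) (there y∈S) eq = cong suc (rank-injective x∈S y∈S eq)

injectiveOn⇒∣S∣≤ : ∀ {n m} (S : Subset n) (g : Fin n → Fin m) →
                   (∀ {x y} → x ∈ S → y ∈ S → g x ≡ g y → x ≡ y) → ∣ S ∣ ≤ℕ m
injectiveOn⇒∣S∣≤ S g inj =
  injective⇒≤ {f = g ∘ elements S} (elements-injective S ∘ inj (elements-∈ S _) (elements-∈ S _))

∣p∪q∣≤∣p∣+∣q∣ : ∀ {n} (p q : Subset n) → ∣ p ∪ q ∣ ≤ℕ ∣ p ∣ +ℕ ∣ q ∣
∣p∪q∣≤∣p∣+∣q∣ []            []            = z≤n
∣p∪q∣≤∣p∣+∣q∣ (outside ∷ p) (outside ∷ q) = ∣p∪q∣≤∣p∣+∣q∣ p q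
∣p∪q∣≤∣p∣+∣q∣ (outside ∷ p) (inside  ∷ q) =
  ℕ.≤-trans (s≤s (∣p∪q∣≤∣p∣+∣q∣ p q)) (ℕ.≤-reflexive (sym (ℕ.+-suc ∣ p ∣ ∣ q ∣)))
∣p∪q∣≤∣p∣+∣q∣ (inside  ∷ p) (outside ∷ q) = s≤s (∣p∪q∣≤∣p∣+∣q∣ p q)
∣p∪q∣≤∣p∣+∣q∣ (inside  ∷ p) (inside  ∷ q) =
  s≤s (ℕ.≤-trans (∣p∪q∣≤∣p∣+∣q∣ p q) (ℕ.+-monoʳ-≤ ∣ p ∣ (ℕ.n≤1+n ∣ q ∣)))

distinct⇒2≤ : ∀ {m} (i j : Fin m) → i ≢ j → 2 ≤ℕ m
distinct⇒2≤ {suc zero}    zero zero i≢j = contradiction refl i≢j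
distinct⇒2≤ {suc (suc m)} i    j    i≢j = s≤s (s≤s z≤n)

distinct∈⇒2≤∣S∣ : ∀ {n} {S : Subset n} {x y} → x ∈ S → y ∈ S → x ≢ y → 2 ≤ℕ ∣ S ∣
distinct∈⇒2≤∣S∣ x∈S y∈S x≢y = distinct⇒2≤ (rank x∈S) (rank y∈S) (x≢y ∘ rank-injective x∈S y∈S)

2≤∣S∣⇒distinct∈ : ∀ {n} (S : Subset n) → 2 ≤ℕ ∣ S ∣ → ∃₂ λ x y → x ∈ S × y ∈ S × x ≢ y
2≤∣S∣⇒distinct∈ S 2≤ =
  elements S i , elements S j , elements-∈ S i , elements-∈ S j , i≢j ∘ elements-injective S
  where
  i j : Fin ∣ S ∣
  i = inject≤ zero 2≤
  j = inject≤ (suc zero) 2≤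
  i≢j : i ≢ j
  i≢j eq with () ← Fin.inject≤-injective 2≤ 2≤ zero (suc zero) eq

-- Lengths of lists without repetitions

lookup-injective : ∀ {a} {A : Set a} {xs : List A} → Unique xs → ∀ {i j} → lookup xs i ≡ lookup xs j → i ≡ j
lookup-injective (x∉ ∷ u) {zero}  {zero}  eq = refl
lookup-injective (x∉ ∷ u) {zero}  {suc j} eq = contradiction eq (All.lookup x∉ (∈-lookup j))
lookup-injective (x∉ ∷ u) {suc i} {zero}  eq = contradiction (sym eq) (All.lookup x∉ (∈-lookup i))
lookup-injective (x∉ ∷ u) {suc i} {suc j} eq = cong suc (lookup-injective u eq)

-- Choosing a preimage under `F` for every entry is injective on positions, because different
-- positions hold different entries. Upper bounds on the number of closure-lines come from such
-- parametrisations.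
covered⇒length≤ : ∀ {a} {A : Set a} {xs : List A} {m} → Unique xs → (F : Fin m → A) →
                  (∀ {x} → x List.∈ xs → ∃ λ c → F c ≡ x) → length xs ≤ℕ m
covered⇒length≤ {xs = xs} u F cover = injective⇒≤ {f = code} code-injective
  where
  code : Fin (length xs) → Fin _
  code i = proj₁ (cover (∈-lookup i))
  code-injective : ∀ {i j} → code i ≡ code j → i ≡ j
  code-injective {i} {j} eq = lookup-injective u
    (trans (sym (proj₂ (cover (∈-lookup i)))) (trans (cong F eq) (proj₂ (cover (∈-lookup j)))))

-- Closure-lines

module _ {n : ℕ} (H : Hypergraph n) where

  span : Fin n → Fin n → Subset n
  span u v = aff H (⁅ u ⁆ ∪ ⁅ v ⁆)

  span-∈-closureLines : ∀ {u v} → u ≢ v → span u v List.∈ closureLines H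
  span-∈-closureLines {u} {v} u≢v = ∈-deduplicate⁺ _≟ˢ_
    (∈-map⁺ _ (∈-filter⁺ (λ (x , y) → ¬? (x Fin.≟ y)) (∈-cartesianProduct⁺ (∈-allFin u) (∈-allFin v)) u≢v))

  ∈-closureLines⁻ : ∀ {L} → L List.∈ closureLines H → ∃₂ λ u v → u ≢ v × L ≡ span u v
  ∈-closureLines⁻ L∈ with ∈-map⁻ _ (∈-deduplicate⁻ _≟ˢ_ _ L∈)
  ... | (u , v) , uv∈ , eq = u , v , u≢v , eq
    where
    u≢v : u ≢ v
    u≢v = proj₂ (∈-filter⁻ (λ (x , y) → ¬? (x Fin.≟ y)) {xs = cartesianProduct (allFin n) (allFin n)} uv∈)

  closureLines-unique : Unique (closureLines H)
  closureLines-unique = deduplicate-! _≟ˢ_ _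

  linesAtMost : ∀ {k} → (∀ {u v} → u ≢ v → ∣ span u v ∣ ≤ℕ k) → LinesAtMost k H
  linesAtMost {k} bound = All.tabulate λ L∈ →
    let (u , v , u≢v , eq) = ∈-closureLines⁻ L∈ in subst (λ L → ∣ L ∣ ≤ℕ k) (sym eq) (bound u≢v)

  -- One half of the universal property of the closure; `span-maximal` is the other half. Together
  -- they identify a closure-line without unfolding the intersection.
  span-minimal : ∀ {u v} T → AffinelyClosed H T → u ∈ T → v ∈ T → span u v ⊆ T
  span-minimal {u} {v} T closed u∈T v∈T x∈ = Equivalence.to (∈-aff H _) x∈ T closed uv⊆T
    where
    uv⊆T : ⁅ u ⁆ ∪ ⁅ v ⁆ ⊆ T
    uv⊆T y∈ with x∈p∪q⁻ ⁅ u ⁆ ⁅ v ⁆ y∈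
    ... | inj₁ y∈u rewrite x∈⁅y⁆⇒x≡y u y∈u = u∈T
    ... | inj₂ y∈v rewrite x∈⁅y⁆⇒x≡y v y∈v = v∈T

  span-maximal : ∀ {u v} S → (∀ T → AffinelyClosed H T → u ∈ T → v ∈ T → S ⊆ T) → S ⊆ span u v
  span-maximal S S⊆ x∈S = Equivalence.from (∈-aff H _) λ T closed uv⊆T →
    S⊆ T closed (uv⊆T (x∈p∪q⁺ (inj₁ (x∈⁅x⁆ _)))) (uv⊆T (x∈p∪q⁺ (inj₂ (x∈⁅x⁆ _)))) x∈S

  left-∈-span : ∀ {u v} → u ∈ span u v
  left-∈-span = span-maximal ⁅ _ ⁆
    (λ T _ u∈T _ x∈ → subst (_∈ T) (sym (x∈⁅y⁆⇒x≡y _ x∈)) u∈T) (x∈⁅x⁆ _)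

  right-∈-span : ∀ {u v} → v ∈ span u v
  right-∈-span = span-maximal ⁅ _ ⁆
    (λ T _ _ v∈T x∈ → subst (_∈ T) (sym (x∈⁅y⁆⇒x≡y _ x∈)) v∈T) (x∈⁅x⁆ _)

-- The lower bound

module _ {n′ k′ : ℕ} (Ls : List (Subset (suc n′))) (L≤k : All (λ L → ∣ L ∣ ≤ℕ suc k′) Ls)
         (cover : ∀ {u v : Fin (suc n′)} → u ≢ v → ∃ λ i → u ∈ lookup Ls i × v ∈ lookup Ls i) where

  private
    position : ∀ i {x} → x ∈ lookup Ls i → Fin (suc k′)
    position i x∈ = inject≤ (rank x∈) (All.lookup L≤k (∈-lookup i))

    position-injective : ∀ {i j x y} (x∈ : x ∈ lookup Ls i) (y∈ : y ∈ lookup Ls j) → i ≡ j →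
                         position i x∈ ≡ position j y∈ → x ≡ y
    position-injective x∈ y∈ refl eq = rank-injective x∈ y∈ (Fin.inject≤-injective _ _ _ _ eq)

    punchOut-injective₂ : ∀ {l} {a b c d : Fin (suc l)} (a≢b : a ≢ b) (c≢d : c ≢ d) →
                          a ≡ c → punchOut a≢b ≡ punchOut c≢d → b ≡ d
    punchOut-injective₂ a≢b c≢d refl eq = Fin.punchOut-injective a≢b c≢d eq

    module _ {u v : Fin (suc n′)} (u≢v : u ≢ v) where

      index : Fin (length Ls)
      index = proj₁ (cover u≢v)

      u∈ : u ∈ lookup Ls index
      u∈ = proj₁ (proj₂ (cover u≢v))

      v∈ : v ∈ lookup Ls index
      v∈ = proj₂ (proj₂ (cover u≢v))

      distinct : position index u∈ ≢ position index v∈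
      distinct eq = u≢v (position-injective u∈ v∈ refl eq)

      -- The second position skips the first one, which leaves `k′` values for it. This is what
      -- yields k(k-1) in place of k².
      code : Fin (length Ls *ℕ (suc k′ *ℕ k′))
      code = combine index (combine (position index u∈) (punchOut distinct))

    code-injective : ∀ {u v u′ v′} (p : u ≢ v) (q : u′ ≢ v′) → code p ≡ code q → u ≡ u′ × v ≡ v′
    code-injective p q eq
      with i≡ , eq′ ← Fin.combine-injective (index p) _ (index q) _ eq
      with a≡ , b≡  ← Fin.combine-injective (position (index p) (u∈ p)) (punchOut (distinct p))
                                            (position (index q) (u∈ q)) (punchOut (distinct q)) eq′
      = position-injective (u∈ p) (u∈ q) i≡ a≡ ,
        position-injective (v∈ p) (v∈ q) i≡ (punchOut-injective₂ (distinct p) (distinct q) a≡ b≡)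

    -- Here `(u , w)` stands for the ordered pair of `u` and `punchIn u w`, so that exactly the
    -- n(n-1) pairs of distinct vertices are coded.
    pairCode : Fin (suc n′) × Fin n′ → Fin (length Ls *ℕ (suc k′ *ℕ k′))
    pairCode (u , w) = code (Fin.punchInᵢ≢i u w ∘ sym)

    pairCode-injective : ∀ p q → pairCode p ≡ pairCode q → p ≡ q
    pairCode-injective (u , w) (u′ , w′) eq
      with refl , eq′ ← code-injective (Fin.punchInᵢ≢i u w ∘ sym) (Fin.punchInᵢ≢i u′ w′ ∘ sym) eq
      = cong (u ,_) (Fin.punchIn-injective u w w′ eq′)

  pairs≤lines*pairs : suc n′ *ℕ n′ ≤ℕ length Ls *ℕ (suc k′ *ℕ k′)
  pairs≤lines*pairs = injective⇒≤ {f = pairCode ∘ remQuot {suc n′} n′} λ {c} {d} eq →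
    trans (sym (Fin.combine-remQuot {suc n′} n′ c))
      (trans (cong (uncurry combine) (pairCode-injective _ _ eq)) (Fin.combine-remQuot {suc n′} n′ d))

closureLines-lowerBound : ∀ {n′ k′} (H : Hypergraph (suc n′)) → LinesAtMost (suc k′) H →
                          suc n′ *ℕ n′ ≤ℕ length (closureLines H) *ℕ (suc k′ *ℕ k′)
closureLines-lowerBound H L≤k = pairs≤lines*pairs (closureLines H) L≤k λ {u} {v} u≢v →
  let uv∈ = span-∈-closureLines H u≢v in
    Any.index uv∈
  , subst (u ∈_) (lookup-index uv∈) (left-∈-span H)
  , subst (v ∈_) (lookup-index uv∈) (right-∈-span H)

-- Existence of the minimum

sublists : ∀ {a} {A : Set a} → List A → List (List A)
sublists []       = [ [] ]
sublists (x ∷ xs) = sublists xs ++ map (x ∷_) (sublists xs)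

filter-∈-sublists : ∀ {a p} {A : Set a} {P : A → Set p} (P? : Decidable P) xs → filter P? xs List.∈ sublists xs
filter-∈-sublists P? []       = here refl
filter-∈-sublists P? (x ∷ xs) with does (P? x)
... | true  = ∈-++⁺ʳ (sublists xs) (∈-map⁺ (x ∷_) (filter-∈-sublists P? xs))
... | false = ∈-++⁺ˡ (filter-∈-sublists P? xs)

-- Repetitions and order of the edges do not matter, so it is enough to compare
-- the hypergraphs that occur as sublists of the list of all subsets.
module _ {n : ℕ} (H : Hypergraph n) where

  private
    _∈H? : Decidable (List._∈ H)
    e ∈H? = DecMembership._∈?_ _≟ˢ_ e H

  normalise : Hypergraph n
  normalise = filter _∈H? (allSubsets n)

  normalise-closed : ∀ {T} → AffinelyClosed H T → AffinelyClosed normalise T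
  normalise-closed closed = All.tabulate λ e∈ → All.lookup closed (proj₂ (∈-filter⁻ _∈H? {xs = allSubsets n} e∈))

  normalise-closed⁻ : ∀ {T} → AffinelyClosed normalise T → AffinelyClosed H T
  normalise-closed⁻ closed = All.tabulate λ {e} e∈ → All.lookup closed (∈-filter⁺ _∈H? (∈-allSubsets e) e∈)

  -- Both hypergraphs have the same affinely closed sets, so the two filters select the same list of
  -- sets to intersect.
  aff-normalise : ∀ S → aff normalise S ≡ aff H S
  aff-normalise S = cong ⋂ (filter-≐
    (λ T → affinelyClosed? normalise T ×-dec (S ⊆? T)) (λ T → affinelyClosed? H T ×-dec (S ⊆? T))
    ((λ (closed , S⊆T) → normalise-closed⁻ closed , λ {x} → S⊆T {x}) ,
     (λ (closed , S⊆T) → normalise-closed closed , λ {x} → S⊆T {x}))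
    (allSubsets n))

  closureLines-normalise : closureLines normalise ≡ closureLines H
  closureLines-normalise = cong (deduplicate _≟ˢ_)
    (map-cong (λ (u , v) → aff-normalise (⁅ u ⁆ ∪ ⁅ v ⁆)) (distinctPairs H))

minLines-exists : ∀ {n k} (H : Hypergraph n) → LinesAtMost k H →
                  Σ[ m ∈ ℕ ] IsMinLines n k m × m ≤ℕ length (closureLines H)
minLines-exists {n} {k} H L≤k =
  lines H* , record { attained = H* , H*-lines , refl ; minimal = H*-minimal }
           , f[argmin]≤f[⊤] {f = lines} H candidates
  where
  open Data.List.Extrema ℕ.≤-totalOrder

  lines : Hypergraph n → ℕ
  lines G = length (closureLines G)

  linesAtMost? : Decidable (LinesAtMost {n} k)
  linesAtMost? G = all? (λ L → ∣ L ∣ ℕ.≤? k) (closureLines G)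

  candidates : List (Hypergraph n)
  candidates = filter linesAtMost? (sublists (allSubsets n))

  -- The given `H` is the default value of `argmin`: it already satisfies the size bound, and the
  -- minimum is at most its number of lines.
  H* : Hypergraph n
  H* = argmin lines H candidates

  H*-lines : LinesAtMost k H*
  H*-lines = argmin-all lines {P = LinesAtMost k} L≤k (all-filter linesAtMost? (sublists (allSubsets n)))

  H*-minimal : ∀ G → LinesAtMost k G → lines H* ≤ℕ lines G
  -- An arbitrary competitor is compared through its normal form, which has the same closure-lines
  -- and occurs among the finitely many candidates.
  H*-minimal G G≤k = subst (λ Ls → lines H* ≤ℕ length Ls) (closureLines-normalise G)
    (All.lookup (f[argmin]≤f[xs] {f = lines} H candidates)
      (∈-filter⁺ linesAtMost? (filter-∈-sublists _ (allSubsets n))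
        (subst (All (λ L → ∣ L ∣ ≤ℕ k)) (sym (closureLines-normalise G)) G≤k)))

-- Crude bounds: ordered pairs of vertices, and the hypergraph without edges

∣closureLines∣≤pairs : ∀ {n′} (H : Hypergraph (suc n′)) → length (closureLines H) ≤ℕ suc n′ *ℕ n′
∣closureLines∣≤pairs {n′} H = covered⇒length≤ (closureLines-unique H) (spanOf ∘ remQuot {suc n′} n′) cover
  where
  spanOf : Fin (suc n′) × Fin n′ → Subset (suc n′)
  spanOf (u , w) = span H u (punchIn u w)

  cover : ∀ {L} → L List.∈ closureLines H → ∃ λ c → spanOf (remQuot {suc n′} n′ c) ≡ L
  cover L∈ with u , v , u≢v , refl ← ∈-closureLines⁻ H L∈ =
    combine u (punchOut u≢v) ,
    trans (cong spanOf (Fin.remQuot-combine u (punchOut u≢v))) (cong (span H u) (Fin.punchIn-punchOut u≢v))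

-- Without edges every set is affinely closed, so the closure of a pair is the pair itself.
edgeless-linesAtMost : ∀ {n k} → 2 ≤ℕ k → LinesAtMost {n} k []
edgeless-linesAtMost 2≤k = linesAtMost [] λ {u} {v} _ →
  ℕ.≤-trans (p⊆q⇒∣p∣≤∣q∣ (span-minimal [] (⁅ u ⁆ ∪ ⁅ v ⁆) [] (x∈p∪q⁺ (inj₁ (x∈⁅x⁆ u))) (x∈p∪q⁺ (inj₂ (x∈⁅x⁆ v)))))
  (ℕ.≤-trans (∣p∪q∣≤∣p∣+∣q∣ ⁅ u ⁆ ⁅ v ⁆)
  (ℕ.≤-trans (ℕ.≤-reflexive (cong₂ _+ℕ_ (∣⁅x⁆∣≡1 u) (∣⁅x⁆∣≡1 v))) 2≤k))

-- x ∙ y is the third point on the line through x and y.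

record SteinerQuasigroup (P : ℕ) : Set where
  infixl 7 _∙_
  field
    _∙_    : Fin P → Fin P → Fin P
    comm   : ∀ p q → p ∙ q ≡ q ∙ p
    idem   : ∀ p → p ∙ p ≡ p
    cancel : ∀ p q → p ∙ (p ∙ q) ≡ q

𝔽₃ : SteinerQuasigroup 3
𝔽₃ = record
  { _∙_    = _∙_
  ; comm   = from-yes (Fin.all? λ p → Fin.all? λ q → p ∙ q Fin.≟ q ∙ p)
  ; idem   = from-yes (Fin.all? λ p → p ∙ p Fin.≟ p)
  ; cancel = from-yes (Fin.all? λ p → Fin.all? λ q → p ∙ (p ∙ q) Fin.≟ q)
  }
  where
  _∙_ : Fin 3 → Fin 3 → Fin 3
  -- 2 (p + q) = − p − q
  p ∙ q = (2 *ℕ (toℕ p +ℕ toℕ q)) mod 3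

product : ∀ {P Q} → SteinerQuasigroup P → SteinerQuasigroup Q → SteinerQuasigroup (P *ℕ Q)
product {P} {Q} S T = record
  { _∙_    = λ x y → join (split x ⊗ split y)
  ; comm   = λ x y → cong join (cong₂ _,_ (S.comm _ _) (T.comm _ _))
  ; idem   = λ x → trans (cong join (cong₂ _,_ (S.idem _) (T.idem _))) (join-split x)
  ; cancel = λ x y → trans
      (cong (λ z → join (split x ⊗ z)) (Fin.remQuot-combine (proj₁ (split x ⊗ split y)) (proj₂ (split x ⊗ split y))))
      (trans (cong join (cong₂ _,_ (S.cancel _ _) (T.cancel _ _))) (join-split y))
  }
  where
  module S = SteinerQuasigroup S
  module T = SteinerQuasigroup T

  split : Fin (P *ℕ Q) → Fin P × Fin Q
  split = remQuot {P} Q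

  join : Fin P × Fin Q → Fin (P *ℕ Q)
  join = uncurry combine

  join-split : ∀ x → join (split x) ≡ x
  join-split = Fin.combine-remQuot {P} Q

  _⊗_ : Fin P × Fin Q → Fin P × Fin Q → Fin P × Fin Q
  (p , q) ⊗ (p′ , q′) = p S.∙ p′ , q T.∙ q′

-- The points are the vectors over F₃ of length `d`, coded as numbers, and the operation is -x - y
-- in each coordinate. In dimension 0 there is one point, so a projection serves.
affineSpace : ∀ d → SteinerQuasigroup (3 ^ d)
affineSpace zero    = record
  { _∙_    = λ _ q → q
  ; comm   = λ { zero zero → refl }
  ; idem   = λ _ → refl
  ; cancel = λ _ _ → refl
  }
affineSpace (suc d) = product 𝔽₃ (affineSpace d)

-- The hypergraph pulled back from a Steiner quasigroup

module Pullback {n P : ℕ} (S : SteinerQuasigroup P)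
                (f : Fin n → Fin P) (f-surjective : ∀ p → ∃ λ x → f x ≡ p) where

  open SteinerQuasigroup S

  fibre : Fin P → Subset n
  fibre p = tabulate λ x → does (f x Fin.≟ p)

  ∈-fibre⁺ : ∀ {x p} → f x ≡ p → x ∈ fibre p
  ∈-fibre⁺ {x} {p} eq = lookup⇒[]= x _ (trans (lookup∘tabulate _ x) (dec-true (f x Fin.≟ p) eq))

  ∈-fibre⁻ : ∀ {x p} → x ∈ fibre p → f x ≡ p
  ∈-fibre⁻ {x} {p} x∈ with f x Fin.≟ p | trans (sym (lookup∘tabulate (λ x → does (f x Fin.≟ p)) x)) ([]=⇒lookup x∈)
  ... | yes eq | _ = eq

  -- For `p ≡ q` this degenerates to the single fibre over `p`, since `p ∙ p ≡ p`.
  line : Fin P → Fin P → Subset n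
  line p q = fibre p ∪ (fibre q ∪ fibre (p ∙ q))

  data On (p q : Fin P) : Fin P → Set where
    fst : On p q p
    snd : On p q q
    trd : On p q (p ∙ q)

  ∈-line⁺ : ∀ {p q x} → On p q (f x) → x ∈ line p q
  ∈-line⁺ {p} {q} {x} on = go on refl
    where
    -- The index `f x` is generalised to a variable `t`, which makes matching on `On` possible.
    go : ∀ {t} → On p q t → f x ≡ t → x ∈ line p q
    go fst eq = x∈p∪q⁺ (inj₁ (∈-fibre⁺ eq))
    go snd eq = x∈p∪q⁺ (inj₂ (x∈p∪q⁺ (inj₁ (∈-fibre⁺ eq))))
    go trd eq = x∈p∪q⁺ (inj₂ (x∈p∪q⁺ (inj₂ (∈-fibre⁺ eq))))

  ∈-line⁻ : ∀ {p q x} → x ∈ line p q → On p q (f x)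
  ∈-line⁻ {p} {q} {x} x∈ with x∈p∪q⁻ (fibre p) _ x∈
  ... | inj₁ x∈p = subst (On p q) (sym (∈-fibre⁻ x∈p)) fst
  ... | inj₂ x∈qr with x∈p∪q⁻ (fibre q) _ x∈qr
  ... | inj₁ x∈q = subst (On p q) (sym (∈-fibre⁻ x∈q)) snd
  ... | inj₂ x∈r = subst (On p q) (sym (∈-fibre⁻ x∈r)) trd

  -- The three points of a line form a subquasigroup: each of the nine products reduces by `idem`,
  -- `comm` and `cancel`.
  on-∙ : ∀ {p q s t} → On p q s → On p q t → On p q (s ∙ t)
  on-∙ {p} {q} fst fst = subst (On p q) (sym (idem p)) fst
  on-∙ {p} {q} fst snd = trd
  on-∙ {p} {q} fst trd = subst (On p q) (sym (cancel p q)) snd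
  on-∙ {p} {q} snd fst = subst (On p q) (comm p q) trd
  on-∙ {p} {q} snd snd = subst (On p q) (sym (idem q)) snd
  on-∙ {p} {q} snd trd = subst (On p q) (sym (trans (cong (q ∙_) (comm p q)) (cancel q p))) fst
  on-∙ {p} {q} trd fst = subst (On p q) (sym (trans (comm _ p) (cancel p q))) snd
  on-∙ {p} {q} trd snd = subst (On p q) (sym (trans (comm _ q) (trans (cong (q ∙_) (comm p q)) (cancel q p)))) fst
  on-∙ {p} {q} trd trd = subst (On p q) (sym (idem _)) trd

  -- Admitting every edge with this property gives the largest hypergraph in which all sets
  -- `line p q` are closed. What remains is to find enough edges to generate these sets.
  KeepsLinesClosed : Subset n → Set
  KeepsLinesClosed e = ∀ p q → 2 ≤ℕ ∣ e ∩ line p q ∣ → e ⊆ line p q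

  keepsLinesClosed? : Decidable KeepsLinesClosed
  keepsLinesClosed? e = Fin.all? λ p → Fin.all? λ q → (2 ℕ.≤? ∣ e ∩ line p q ∣) →-dec (e ⊆? line p q)

  H : Hypergraph n
  H = filter keepsLinesClosed? (allSubsets n)

  line-closed : ∀ p q → AffinelyClosed H (line p q)
  line-closed p q = All.tabulate λ {e} e∈ 2≤ {x} →
    proj₂ (∈-filter⁻ keepsLinesClosed? {xs = allSubsets n} e∈) p q 2≤ {x}

  triple : Fin n → Fin n → Fin n → Subset n
  triple x y z = ⁅ x ⁆ ∪ (⁅ y ⁆ ∪ ⁅ z ⁆)

  ∈-triple⁻ : ∀ {x y z w} → w ∈ triple x y z → w ≡ x ⊎ w ≡ y ⊎ w ≡ z
  ∈-triple⁻ {x} {y} {z} w∈ with x∈p∪q⁻ ⁅ x ⁆ _ w∈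
  ... | inj₁ w∈x = inj₁ (x∈⁅y⁆⇒x≡y x w∈x)
  ... | inj₂ w∈yz with x∈p∪q⁻ ⁅ y ⁆ _ w∈yz
  ... | inj₁ w∈y = inj₂ (inj₁ (x∈⁅y⁆⇒x≡y y w∈y))
  ... | inj₂ w∈z = inj₂ (inj₂ (x∈⁅y⁆⇒x≡y z w∈z))

  -- Each of the three images is the product of the other two, and lines are closed under `∙`. So
  -- two different vertices of the triple on a line force the remaining one onto it.
  triple-keepsLinesClosed : ∀ {x y z} → f z ≡ f x ∙ f y → KeepsLinesClosed (triple x y z)
  triple-keepsLinesClosed {x} {y} {z} eq p q 2≤
    with a , b , a∈ , b∈ , a≢b ← 2≤∣S∣⇒distinct∈ (triple x y z ∩ line p q) 2≤
    with a∈e , a∈L ← x∈p∩q⁻ (triple x y z) _ a∈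
    with b∈e , b∈L ← x∈p∩q⁻ (triple x y z) _ b∈
    = go (∈-triple⁻ a∈e) (∈-triple⁻ b∈e)
    where
    eqʸ : f y ≡ f x ∙ f z
    eqʸ = sym (trans (cong (f x ∙_) eq) (cancel (f x) (f y)))

    eqˣ : f x ≡ f y ∙ f z
    eqˣ = sym (trans (cong (f y ∙_) (trans eq (comm (f x) (f y)))) (cancel (f y) (f x)))

    on : ∀ {u v w} → f w ≡ f u ∙ f v → u ∈ line p q → v ∈ line p q → w ∈ line p q
    on eq u∈ v∈ = ∈-line⁺ (subst (On p q) (sym eq) (on-∙ (∈-line⁻ u∈) (∈-line⁻ v∈)))

    all : x ∈ line p q → y ∈ line p q → z ∈ line p q → triple x y z ⊆ line p q
    all x∈ y∈ z∈ w∈ with ∈-triple⁻ w∈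
    ... | inj₁ refl        = x∈
    ... | inj₂ (inj₁ refl) = y∈
    ... | inj₂ (inj₂ refl) = z∈

    xy : x ∈ line p q → y ∈ line p q → triple x y z ⊆ line p q
    xy x∈ y∈ = all x∈ y∈ (on eq x∈ y∈)

    xz : x ∈ line p q → z ∈ line p q → triple x y z ⊆ line p q
    xz x∈ z∈ = all x∈ (on eqʸ x∈ z∈) z∈

    yz : y ∈ line p q → z ∈ line p q → triple x y z ⊆ line p q
    yz y∈ z∈ = all (on eqˣ y∈ z∈) y∈ z∈

    go : a ≡ x ⊎ a ≡ y ⊎ a ≡ z → b ≡ x ⊎ b ≡ y ⊎ b ≡ z → triple x y z ⊆ line p q
    go (inj₁ refl)        (inj₁ refl)        = contradiction refl a≢b
    go (inj₁ refl)        (inj₂ (inj₁ refl)) = xy a∈L b∈L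
    go (inj₁ refl)        (inj₂ (inj₂ refl)) = xz a∈L b∈L
    go (inj₂ (inj₁ refl)) (inj₁ refl)        = xy b∈L a∈L
    go (inj₂ (inj₁ refl)) (inj₂ (inj₁ refl)) = contradiction refl a≢b
    go (inj₂ (inj₁ refl)) (inj₂ (inj₂ refl)) = yz a∈L b∈L
    go (inj₂ (inj₂ refl)) (inj₁ refl)        = xz b∈L a∈L
    go (inj₂ (inj₂ refl)) (inj₂ (inj₁ refl)) = yz b∈L a∈L
    go (inj₂ (inj₂ refl)) (inj₂ (inj₂ refl)) = contradiction refl a≢b

  -- The triple is an edge that meets `T` in `x` and `y`. Since `z` is any vertex over `f x ∙ f y`,
  -- two distinct vertices of `T` bring in a whole fibre; if they lie over the same point, it is
  -- their own.
  third-∈ : ∀ {T x y z} → AffinelyClosed H T → x ≢ y → x ∈ T → y ∈ T → f z ≡ f x ∙ f y → z ∈ T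
  third-∈ {T} {x} {y} {z} closed x≢y x∈T y∈T eq =
    All.lookup closed (∈-filter⁺ keepsLinesClosed? (∈-allSubsets e)
        (λ p q 2≤ {w} → triple-keepsLinesClosed eq p q 2≤ {w}))
      (distinct∈⇒2≤∣S∣ (x∈p∩q⁺ (x∈e , x∈T)) (x∈p∩q⁺ (y∈e , y∈T)) x≢y) z∈e
    where
    e = triple x y z
    x∈e : x ∈ e
    x∈e = x∈p∪q⁺ (inj₁ (x∈⁅x⁆ x))
    y∈e : y ∈ e
    y∈e = x∈p∪q⁺ (inj₂ (x∈p∪q⁺ (inj₁ (x∈⁅x⁆ y))))
    z∈e : z ∈ e
    z∈e = x∈p∪q⁺ (inj₂ (x∈p∪q⁺ (inj₂ (x∈⁅x⁆ z))))

  -- A vertex over f u ∙ f v exists by surjectivity; with v and u it generates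
  -- the fibres of f u and of f v.
  line⊆closed : ∀ {T u v} → AffinelyClosed H T → u ≢ v → u ∈ T → v ∈ T → line (f u) (f v) ⊆ T
  line⊆closed {T} {u} {v} closed u≢v u∈T v∈T {x} x∈ = go (∈-line⁻ x∈) refl
    where
    p = f u
    q = f v
    z  = proj₁ (f-surjective (p ∙ q))
    fz = proj₂ (f-surjective (p ∙ q))

    z∈T : z ∈ T
    z∈T = third-∈ closed u≢v u∈T v∈T fz

    -- If `u` were `z`, then `p ≡ p ∙ q`, and applying `p ∙_` to both sides would give `p ≡ q`.
    u≢z : p ≢ q → u ≢ z
    u≢z p≢q u≡z = p≢q (trans (sym (idem p)) (trans (cong (p ∙_) (trans (cong f u≡z) fz)) (cancel p q)))

    v≢z : p ≢ q → v ≢ z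
    v≢z p≢q v≡z = p≢q (sym (trans (sym (idem q))
      (trans (cong (q ∙_) (trans (cong f v≡z) (trans fz (comm p q)))) (cancel q p))))

    go : ∀ {t} → On p q t → f x ≡ t → x ∈ T
    go trd eq = third-∈ closed u≢v u∈T v∈T eq
    go fst eq with p Fin.≟ q
    -- Over a single point `p ∙ q` is `p` again, so `u` and `v` generate their fibre directly,
    -- without help from `z`.
    ... | yes p≡q = third-∈ closed u≢v u∈T v∈T (trans eq (trans (sym (idem p)) (cong (p ∙_) p≡q)))
    ... | no  p≢q = third-∈ closed (v≢z p≢q) v∈T z∈T
      (trans eq (sym (trans (cong (q ∙_) (trans fz (comm p q))) (cancel q p))))
    go snd eq with p Fin.≟ q
    ... | yes p≡q = third-∈ closed u≢v u∈T v∈T (trans eq (trans (sym (idem q)) (cong (_∙ q) (sym p≡q))))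
    ... | no  p≢q = third-∈ closed (u≢z p≢q) u∈T z∈T
      (trans eq (sym (trans (cong (p ∙_) fz) (cancel p q))))

  span≡line : ∀ {u v} → u ≢ v → span H u v ≡ line (f u) (f v)
  span≡line {u} {v} u≢v = ⊆-antisym
    (span-minimal H (line (f u) (f v)) (line-closed (f u) (f v)) (∈-line⁺ fst) (∈-line⁺ snd))
    (span-maximal H (line (f u) (f v)) λ T closed u∈T v∈T {x} → line⊆closed closed u≢v u∈T v∈T {x})

  -- All pairs of points serve as parameters; those with equal entries account for the closure-lines
  -- inside one fibre.
  ∣closureLines∣≤P² : length (closureLines H) ≤ℕ P *ℕ P
  ∣closureLines∣≤P² = covered⇒length≤ (closureLines-unique H) (uncurry line ∘ remQuot {P} P) cover
    where
    cover : ∀ {L} → L List.∈ closureLines H → ∃ λ c → uncurry line (remQuot {P} P c) ≡ L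
    cover L∈ with u , v , u≢v , refl ← ∈-closureLines⁻ H L∈ =
      combine (f u) (f v) ,
      trans (cong (uncurry line) (Fin.remQuot-combine (f u) (f v))) (sym (span≡line u≢v))

  fibres⇒linesAtMost : ∀ {b} → (∀ p → ∣ fibre p ∣ ≤ℕ b) → LinesAtMost (3 *ℕ b) H
  fibres⇒linesAtMost {b} fibre≤ = linesAtMost H λ {u} {v} u≢v →
    subst (λ L → ∣ L ∣ ≤ℕ 3 *ℕ b) (sym (span≡line u≢v)) (∣line∣≤ (f u) (f v))
    where
    ∣line∣≤ : ∀ p q → ∣ line p q ∣ ≤ℕ 3 *ℕ b
    ∣line∣≤ p q = begin
      ∣ line p q ∣                                       ≤⟨ ∣p∪q∣≤∣p∣+∣q∣ (fibre p) _ ⟩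
      ∣ fibre p ∣ +ℕ ∣ fibre q ∪ fibre (p ∙ q) ∣         ≤⟨ ℕ.+-monoʳ-≤ ∣ fibre p ∣ (∣p∪q∣≤∣p∣+∣q∣ (fibre q) _) ⟩
      ∣ fibre p ∣ +ℕ (∣ fibre q ∣ +ℕ ∣ fibre (p ∙ q) ∣)  ≤⟨ ℕ.+-mono-≤ (fibre≤ p) (ℕ.+-mono-≤ (fibre≤ q) (fibre≤ (p ∙ q))) ⟩
      b +ℕ (b +ℕ b)                                      ≡⟨ cong (λ c → b +ℕ (b +ℕ c)) (sym (ℕ.+-identityʳ b)) ⟩
      3 *ℕ b                                             ∎
      where open ℕ.≤-Reasoning

-- The upper bound

module _ {n P : ℕ} (b : ℕ) .{{_ : NonZero P}} (P≤n : P ≤ℕ n) (n≤bP : n ≤ℕ b *ℕ P) (S : SteinerQuasigroup P) where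

  private
    -- Reduction modulo `P` is onto because `P ≤ n`. A vertex is determined by its residue and its
    -- quotient, and `n ≤ bP` leaves only `b` quotients, which bounds the fibres.
    residue : Fin n → Fin P
    residue x = toℕ x mod P

    toℕ-residue : ∀ x → toℕ (residue x) ≡ toℕ x % P
    toℕ-residue x = Fin.toℕ-fromℕ< (m%n<n (toℕ x) P)

    residue-surjective : ∀ p → ∃ λ x → residue x ≡ p
    residue-surjective p = x , Fin.toℕ-injective
      (trans (toℕ-residue x) (trans (cong (_% P) (Fin.toℕ-inject≤ p P≤n)) (m<n⇒m%n≡m (Fin.toℕ<n p))))
      where x = inject≤ p P≤n

    open Pullback S residue residue-surjective

    quotient< : ∀ x → toℕ x ℕ./ P <ℕ b
    quotient< x = m<n*o⇒m/o<n (ℕ.<-≤-trans (Fin.toℕ<n x) n≤bP)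

    quotient : Fin n → Fin b
    quotient x = fromℕ< (quotient< x)

    residue-quotient-injective : ∀ {x y} → residue x ≡ residue y → quotient x ≡ quotient y → x ≡ y
    residue-quotient-injective {x} {y} r≡ q≡ = Fin.toℕ-injective
      (trans (m≡m%n+[m/n]*n (toℕ x) P)
      (trans (cong₂ (λ r q → r +ℕ q *ℕ P)
               (trans (sym (toℕ-residue x)) (trans (cong toℕ r≡) (toℕ-residue y)))
               (Fin.fromℕ<-injective _ _ (quotient< x) (quotient< y) q≡))
      (sym (m≡m%n+[m/n]*n (toℕ y) P))))

    ∣fibre∣≤b : ∀ p → ∣ fibre p ∣ ≤ℕ b
    ∣fibre∣≤b p = injectiveOn⇒∣S∣≤ (fibre p) quotient λ x∈ y∈ →
      residue-quotient-injective (trans (∈-fibre⁻ x∈) (sym (∈-fibre⁻ y∈)))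

  blowUp : Σ[ H ∈ Hypergraph n ] LinesAtMost (3 *ℕ b) H × length (closureLines H) ≤ℕ P *ℕ P
  blowUp = H , fibres⇒linesAtMost ∣fibre∣≤b , ∣closureLines∣≤P²

-- The dimension of the affine space

n<3^n : ∀ n → n <ℕ 3 ^ n
n<3^n zero    = s≤s z≤n
n<3^n (suc n) = begin-strict
  suc n            ≤⟨ n<3^n n ⟩
  3 ^ n            <⟨ ℕ.m<m+n (3 ^ n) (ℕ.<-≤-trans (ℕ.m^n>0 3 n) (ℕ.m≤m+n (3 ^ n) _)) ⟩
  3 *ℕ 3 ^ n       ∎
  where open ℕ.≤-Reasoning

-- The exponent descends from `t` until the next lower power is too small. It cannot reach 0, as
-- `b < n`.
bracket : ∀ {n b} t → b <ℕ n → n ≤ℕ 3 ^ t *ℕ b → ∃ λ d → 3 ^ d *ℕ b <ℕ n × n ≤ℕ 3 ^ suc d *ℕ b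
bracket {n} {b} zero    b<n n≤ = contradiction (ℕ.≤-trans n≤ (ℕ.≤-reflexive (ℕ.*-identityˡ b))) (ℕ.<⇒≱ b<n)
bracket {n} {b} (suc t) b<n n≤ with n ℕ.≤? 3 ^ t *ℕ b
... | yes n≤′ = bracket t b<n n≤′
... | no  n≰  = t , ℕ.≰⇒> n≰ , n≤

-- The threshold 9 ensures `b ≥ 3`. This absorbs the remainder of k modulo 3, so that k ≤ 4b, and it
-- gives 3^(d+1) ≤ 3^d b < n, so that there are enough vertices to hit every point.
upperBound-large : ∀ {n′ k′} → k′ ≤ℕ n′ → 9 ≤ℕ suc k′ →
  Σ[ H ∈ Hypergraph (suc n′) ] LinesAtMost (suc k′) H ×
    length (closureLines H) *ℕ (suc k′ *ℕ k′) ≤ℕ 144 *ℕ (suc n′ *ℕ n′)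
upperBound-large {n′} {k′} k′≤n′ 9≤k = H , All.map (λ L≤ → ℕ.≤-trans L≤ 3b≤k) H≤3b , bound
  where
  open ℕ.≤-Reasoning
  n k b : ℕ
  n = suc n′
  k = suc k′
  b = k ℕ./ 3

  3≤b : 3 ≤ℕ b
  3≤b = /-monoˡ-≤ 3 9≤k

  3b≤k : 3 *ℕ b ≤ℕ k
  3b≤k = ℕ.≤-trans (ℕ.≤-reflexive (ℕ.*-comm 3 b)) (m/n*n≤m k 3)

  k≤4b : k ≤ℕ 4 *ℕ b
  k≤4b = begin
    k                   ≡⟨ m≡m%n+[m/n]*n k 3 ⟩
    k % 3 +ℕ b *ℕ 3     ≤⟨ ℕ.+-monoˡ-≤ (b *ℕ 3) (ℕ.≤-trans (ℕ.<⇒≤ (m%n<n k 3)) 3≤b) ⟩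
    b +ℕ b *ℕ 3         ≡⟨ cong (b +ℕ_) (ℕ.*-comm b 3) ⟩
    4 *ℕ b              ∎

  b<n : b <ℕ n
  b<n = begin-strict
    b                   <⟨ ℕ.m<m+n b (ℕ.<-≤-trans (ℕ.<-≤-trans (s≤s z≤n) 3≤b) (ℕ.m≤m+n b _)) ⟩
    3 *ℕ b              ≤⟨ 3b≤k ⟩
    k                   ≤⟨ s≤s k′≤n′ ⟩
    n                   ∎

  n≤3^n*b : n ≤ℕ 3 ^ n *ℕ b
  n≤3^n*b = begin
    n                   ≤⟨ ℕ.<⇒≤ (n<3^n n) ⟩
    3 ^ n               ≡⟨ ℕ.*-identityʳ (3 ^ n) ⟨
    3 ^ n *ℕ 1          ≤⟨ ℕ.*-monoʳ-≤ (3 ^ n) (ℕ.≤-trans (s≤s z≤n) 3≤b) ⟩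
    3 ^ n *ℕ b          ∎

  bracketed = bracket n b<n n≤3^n*b
  d : ℕ
  d = proj₁ bracketed

  -- The strict inequality from the bracketing is spent here: a bound by n-1 is what finally
  -- produces n(n-1) instead of n².
  3^d*b≤n′ : 3 ^ d *ℕ b ≤ℕ n′
  3^d*b≤n′ = ℕ.≤-pred (proj₁ (proj₂ bracketed))

  P : ℕ
  P = 3 ^ suc d

  P≤n : P ≤ℕ n
  P≤n = begin
    3 *ℕ 3 ^ d          ≡⟨ ℕ.*-comm 3 (3 ^ d) ⟩
    3 ^ d *ℕ 3          ≤⟨ ℕ.*-monoʳ-≤ (3 ^ d) 3≤b ⟩
    3 ^ d *ℕ b          ≤⟨ ℕ.m≤n⇒m≤1+n 3^d*b≤n′ ⟩
    n                   ∎

  n≤bP : n ≤ℕ b *ℕ P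
  n≤bP = ℕ.≤-trans (proj₂ (proj₂ bracketed)) (ℕ.≤-reflexive (ℕ.*-comm P b))

  construction = blowUp b {{ℕ.m^n≢0 3 (suc d)}} P≤n n≤bP (affineSpace (suc d))
  H    = proj₁ construction
  H≤3b = proj₁ (proj₂ construction)

  -- The factor 12 is the 3 from P = 3 · 3^d times the 4 from k ≤ 4b; its square is the constant
  -- 144.
  Pk≤12n′ : P *ℕ k ≤ℕ 12 *ℕ n′
  Pk≤12n′ = begin
    P *ℕ k                    ≤⟨ ℕ.*-monoʳ-≤ P k≤4b ⟩
    3 *ℕ 3 ^ d *ℕ (4 *ℕ b)    ≡⟨ solve 2 (λ x y → con 3 :* x :* (con 4 :* y) := con 12 :* (x :* y)) refl (3 ^ d) b ⟩
    12 *ℕ (3 ^ d *ℕ b)        ≤⟨ ℕ.*-monoʳ-≤ 12 3^d*b≤n′ ⟩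
    12 *ℕ n′                  ∎
    where open +-*-Solver

  bound : length (closureLines H) *ℕ (k *ℕ k′) ≤ℕ 144 *ℕ (n *ℕ n′)
  bound = begin
    length (closureLines H) *ℕ (k *ℕ k′)   ≤⟨ ℕ.*-monoˡ-≤ (k *ℕ k′) (proj₂ (proj₂ construction)) ⟩
    P *ℕ P *ℕ (k *ℕ k′)                    ≤⟨ ℕ.*-monoʳ-≤ (P *ℕ P) (ℕ.*-monoʳ-≤ k (ℕ.n≤1+n k′)) ⟩
    P *ℕ P *ℕ (k *ℕ k)                     ≡⟨ solve 2 (λ x y → x :* x :* (y :* y) := x :* y :* (x :* y)) refl P k ⟩
    P *ℕ k *ℕ (P *ℕ k)                     ≤⟨ ℕ.*-mono-≤ (ℕ.≤-trans Pk≤12n′ (ℕ.*-monoʳ-≤ 12 (ℕ.n≤1+n n′))) Pk≤12n′ ⟩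
    12 *ℕ n *ℕ (12 *ℕ n′)                  ≡⟨ solve 2 (λ x y → con 12 :* x :* (con 12 :* y) := con 144 :* (x :* y)) refl n n′ ⟩
    144 *ℕ (n *ℕ n′)                       ∎
    where open +-*-Solver

upperBound : ∀ {n′ k′} → k′ ≤ℕ n′ → 2 ≤ℕ suc k′ →
  Σ[ H ∈ Hypergraph (suc n′) ] LinesAtMost (suc k′) H ×
    length (closureLines H) *ℕ (suc k′ *ℕ k′) ≤ℕ 144 *ℕ (suc n′ *ℕ n′)
upperBound {n′} {k′} k′≤n′ 2≤k with 9 ℕ.≤? suc k′
... | yes 9≤k = upperBound-large k′≤n′ 9≤k
... | no  9≰k = [] , edgeless-linesAtMost 2≤k , (begin
  length (closureLines {suc n′} []) *ℕ (suc k′ *ℕ k′)   ≤⟨ ℕ.*-mono-≤ (∣closureLines∣≤pairs {n′} []) kk′≤144 ⟩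
  suc n′ *ℕ n′ *ℕ 144                          ≡⟨ ℕ.*-comm (suc n′ *ℕ n′) 144 ⟩
  144 *ℕ (suc n′ *ℕ n′)                        ∎)
  where
  open ℕ.≤-Reasoning
  -- For k < 9 the bound 12 is generous; it is chosen because 12 · 12 is the constant of the other
  -- case.
  k≤12 : suc k′ ≤ℕ 12
  k≤12 = ℕ.≤-trans (ℕ.<⇒≤ (ℕ.≰⇒> 9≰k)) (ℕ.m≤m+n 9 3)
  kk′≤144 : suc k′ *ℕ k′ ≤ℕ 144
  kk′≤144 = ℕ.*-mono-≤ k≤12 (ℕ.≤-trans (ℕ.n≤1+n k′) k≤12)

-- From products of natural numbers to inequalities between fractions

pos-≤-ℚᵘ : ∀ {a m d e} → a *ℕ suc e ≤ℕ m *ℕ suc d → ℚᵘ.mkℚᵘ (+ a) d ℚᵘ.≤ ℚᵘ.mkℚᵘ (+ m) e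
pos-≤-ℚᵘ {a} {m} {d} {e} le =
  ℚᵘ.*≤* (subst₂ ℤ._≤_ (ℤ.pos-* a (suc e)) (ℤ.pos-* m (suc d)) (ℤ.+≤+ le))

a≤m*d⇒a/d≤m : ∀ a m d .{{_ : NonZero d}} → a ≤ℕ m *ℕ d → (+ a) / d ≤ (+ m) / 1
a≤m*d⇒a/d≤m a m (suc d) a≤ = ℚ.toℚᵘ-cancel-≤ (begin
  toℚᵘ ((+ a) / suc d)   ≃⟨ ℚ.toℚᵘ-fromℚᵘ (ℚᵘ.mkℚᵘ (+ a) d) ⟩
  ℚᵘ.mkℚᵘ (+ a) d        ≤⟨ pos-≤-ℚᵘ (ℕ.≤-trans (ℕ.≤-reflexive (ℕ.*-identityʳ a)) a≤) ⟩
  ℚᵘ.mkℚᵘ (+ m) 0        ≃⟨ ℚ.toℚᵘ-fromℚᵘ (ℚᵘ.mkℚᵘ (+ m) 0) ⟨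
  toℚᵘ ((+ m) / 1)       ∎)
  where open ℚᵘ.≤-Reasoning

m*d≤c*a⇒m≤c*a/d : ∀ a m d .{{_ : NonZero d}} c → m *ℕ d ≤ℕ c *ℕ a → (+ m) / 1 ≤ (+ c) / 1 * ((+ a) / d)
m*d≤c*a⇒m≤c*a/d a m (suc d) c ≤ca = ℚ.toℚᵘ-cancel-≤ (begin
  toℚᵘ ((+ m) / 1)                                  ≃⟨ ℚ.toℚᵘ-fromℚᵘ (ℚᵘ.mkℚᵘ (+ m) 0) ⟩
  ℚᵘ.mkℚᵘ (+ m) 0                                   ≤⟨ pos-≤-ℚᵘ ≤ca′ ⟩
  -- `mkℚᵘ` stores the predecessor of the denominator. It is written here in the form to which the
  -- product of the two fractions computes, so only the numerator has to be rewritten.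
  ℚᵘ.mkℚᵘ (+ (c *ℕ a)) (ℕ.pred (1 *ℕ suc d))        ≡⟨ cong (λ z → ℚᵘ.mkℚᵘ z (ℕ.pred (1 *ℕ suc d))) (ℤ.pos-* c a) ⟩
  ℚᵘ.mkℚᵘ (+ c) 0 ℚᵘ.* ℚᵘ.mkℚᵘ (+ a) d              ≃⟨ ℚᵘ.*-cong (ℚ.toℚᵘ-fromℚᵘ (ℚᵘ.mkℚᵘ (+ c) 0))
                                                                  (ℚ.toℚᵘ-fromℚᵘ (ℚᵘ.mkℚᵘ (+ a) d)) ⟨
  toℚᵘ ((+ c) / 1) ℚᵘ.* toℚᵘ ((+ a) / suc d)        ≃⟨ ℚ.toℚᵘ-homo-* ((+ c) / 1) ((+ a) / suc d) ⟨
  toℚᵘ ((+ c) / 1 * ((+ a) / suc d))                ∎)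
  where
  open ℚᵘ.≤-Reasoning
  ≤ca′ : m *ℕ (1 *ℕ suc d) ≤ℕ c *ℕ a *ℕ 1
  ≤ca′ = subst₂ _≤ℕ_ (cong (m *ℕ_) (sym (ℕ.*-identityˡ (suc d)))) (sym (ℕ.*-identityʳ (c *ℕ a))) ≤ca

theorem9 : Σ[ c ∈ ℚ ] (0ℚ < c × (∀ (n k : ℕ) → k ≤ℕ n → (2≤k : 2 ≤ℕ k) →
    Σ[ m ∈ ℕ ] (IsMinLines n k m
    × pairRatio n k 2≤k ≤ (+ m) / 1
    × (+ m) / 1 ≤ c * pairRatio n k 2≤k)))
theorem9 = (+ 144) / 1 , ℚ.positive⁻¹ _ , λ where
  -- Since 2 ≤ k ≤ n, both numbers are successors. The lower bound is applied to a minimiser `H*`,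
  -- the upper bound to the constructed `H`.
  (suc n′) (suc k′) (s≤s k′≤n′) 2≤k →
    let instance _ = k[k-1]≢0 2≤k
        H , H≤k , H-bound  = upperBound k′≤n′ 2≤k
        m , m-min , m≤H    = minLines-exists H H≤k
        H* , H*≤k , H*≡m   = IsMinLines.attained m-min
        pairs = suc n′ *ℕ n′
        slots = suc k′ *ℕ k′
    in m , m-min
       , a≤m*d⇒a/d≤m pairs m slots
           (subst (λ l → pairs ≤ℕ l *ℕ slots) H*≡m (closureLines-lowerBound H* H*≤k))
       , m*d≤c*a⇒m≤c*a/d pairs m slots 144
           (ℕ.≤-trans (ℕ.*-monoˡ-≤ slots m≤H) H-bound)
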